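{- Let $A\in\mathcal{PM}(n)$ be a poset matrix with row vectors $r_0,\ldots,r_{n-1}$. Then the Boolean row space $\mathsf{Row}_{\mathbb B}(A)=\{\sum_{i\in S} r_i : S\subseteq X_n\}$ (Boolean sums, the empty sum being $\mathbf 0$) equals the set $\mathsf{PV}_n(A)$ of poset vectors of $A$.
   Context: Let $X_n=\{0,1,\ldots,n-1\}$. A naturally labeled (NL) poset on $X_n$ is a partial order $\preceq$ on $X_n$ such that $x\preceq y$ implies $x\le y$ in the usual integer order. Its poset matrix is the $n\times n$ $(0,1)$-matrix $A=(a_{i,j})_{i,j\in X_n}$ with $a_{i,j}=1$ if $j\preceq i$ and $0$ otherwise; $\mathcal{PM}(n)$ is the set of all such matrices. Arithmetic is in the Boolean algebra $\{0,1\}$ ($1+1=1$). For $v\in\{0,1\}^n$ (a row vector), $A^v=\begin{bmatrix}A&\mathbf{0}\\ v&1\end{bmatrix}$, and $v$ is a poset vector of $A$ if $A^v\in\mathcal{PM}(n+1)$; $\mathsf{PV}_n(A)$ is the set of poset vectors of $A$. -}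

module Defs where

open import Data.Bool.Base using (Bool; true; false; _∨_)
open import Data.Fin.Base using (Fin; _≤_)
open import Data.Fin.Subset using (Subset; inside; outside)
open import Data.Nat.Base using (ℕ; suc)
open import Data.Product.Base using (∃)
open import Data.Vec.Base using (Vec; []; _∷_; _∷ʳ_; map; replicate; tabulate; zipWith)
open import Level using (0ℓ) renaming (suc to lsuc)
open import Relation.Binary.Core using (Rel)
open import Relation.Binary.PropositionalEquality.Core using (_≡_)
open import Relation.Binary.Structures using (IsDecPartialOrder)
open import Relation.Nullary.Decidable.Core using (does)
open import Relation.Unary using (Pred; _∈_)

-- X_n is Fin n.  The order is required to be decidable because a (0,1)-matrix
-- "with entry 1 if j ≼ i and 0 otherwise" exists constructively only then;
-- classically this is no restriction.
record NLPoset (n : ℕ) : Set (lsuc 0ℓ) where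
  field
    _≼_               : Rel (Fin n) 0ℓ
    isDecPartialOrder : IsDecPartialOrder _≡_ _≼_
    natural           : ∀ {x y} → x ≼ y → x ≤ y

  open IsDecPartialOrder isDecPartialOrder public
    using () renaming (_≤?_ to _≼?_)

RowVec : ℕ → Set
RowVec n = Vec Bool n

-- Square matrices as vectors of rows: r_i is lookup A i.
Matrix : ℕ → Set
Matrix n = Vec (RowVec n) n

posetMatrix : ∀ {n} → NLPoset n → Matrix n
posetMatrix P = tabulate λ i → tabulate λ j → does (j ≼? i)
  where open NLPoset P

PM : ∀ n → Pred (Matrix n) (lsuc 0ℓ)
PM n A = ∃ λ (P : NLPoset n) → A ≡ posetMatrix P

-- The block matrix [ A 𝟎 ; v 1 ].
_^ᵛ_ : ∀ {n} → Matrix n → RowVec n → Matrix (suc n)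
A ^ᵛ v = map (_∷ʳ false) A ∷ʳ (v ∷ʳ true)

PV : ∀ n → Matrix n → Pred (RowVec n) (lsuc 0ℓ)
PV n A v = (A ^ᵛ v) ∈ PM (suc n)

𝟎 : ∀ {n} → RowVec n
𝟎 {n} = replicate n false

_⊕_ : ∀ {n} → RowVec n → RowVec n → RowVec n
_⊕_ = zipWith _∨_

-- ∑ S rs is the Boolean sum of the vectors lookup rs i over i ∈ S.
∑ : ∀ {m n} → Subset m → Vec (RowVec n) m → RowVec n
∑ []            []       = 𝟎
∑ (inside  ∷ S) (r ∷ rs) = r ⊕ ∑ S rs
∑ (outside ∷ S) (r ∷ rs) = ∑ S rs

Row𝔹 : ∀ {n} → Matrix n → Pred (RowVec n) 0ℓ
Row𝔹 {n} A v = ∃ λ (S : Subset n) → v ≡ ∑ S A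

{-# OPTIONS --safe #-}

-- Both sides are the down-sets of the order.  The row r_i is the principal
-- down-set of i, so Boolean sums of rows are down-closed, and a down-set v is
-- the sum of the rows indexed by v itself.  On the other hand, adding a new
-- top label whose strict predecessors are v preserves transitivity exactly
-- when v is down-closed.
module Submission where

open import Defs
open import Data.Nat.Base using (ℕ)
open import Relation.Unary using (_∈_; _≐_)

open import Data.Bool.Base using (true; false)
open import Data.Fin.Base using (Fin; zero; suc; fromℕ; inject₁; _≤_)
open import Data.Fin.Properties using (_≟_; ≤-antisym; ≤fromℕ; toℕ-inject₁)
open import Data.Fin.Relation.Unary.Top using (view; ‵fromℕ; ‵inject₁)
open import Data.Fin.Subset using (Subset; inside; outside) renaming (_∈_ to _∈ₛ_)
open import Data.Fin.Subset.Properties using (_∈?_; ∉⊥; ⊆-antisym; x∈p∪q⁻; x∈p∪q⁺)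
import Data.Nat.Base as ℕ
open import Data.Product.Base using (∃; _×_; _,_)
open import Data.Sum.Base using (inj₁; inj₂)
open import Data.Vec.Base using (Vec; []; _∷_; _∷ʳ_; here; there; lookup; map; tabulate)
open import Data.Vec.Properties using (lookup-map; lookup∘tabulate; tabulate∘lookup; tabulate-cong; []=⇒lookup; lookup⇒[]=)
open import Relation.Binary.PropositionalEquality using (_≡_; refl; sym; trans; subst; subst₂; isEquivalence)
open import Relation.Binary.Structures using (IsDecPartialOrder)
open import Relation.Nullary.Decidable using (Dec; does; dec-true; _because_)
open import Relation.Nullary.Reflects using (invert)

lookup-∷ʳ-inject₁ : ∀ {a} {A : Set a} {n} (xs : Vec A n) x i → lookup (xs ∷ʳ x) (inject₁ i) ≡ lookup xs i
lookup-∷ʳ-inject₁ (_ ∷ _)  x zero    = refl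
lookup-∷ʳ-inject₁ (_ ∷ xs) x (suc i) = lookup-∷ʳ-inject₁ xs x i

lookup-∷ʳ-fromℕ : ∀ {a} {A : Set a} {n} (xs : Vec A n) x → lookup (xs ∷ʳ x) (fromℕ n) ≡ x
lookup-∷ʳ-fromℕ []       x = refl
lookup-∷ʳ-fromℕ (_ ∷ xs) x = lookup-∷ʳ-fromℕ xs x

inject₁∈∷ʳ⁺ : ∀ {n} {p : Subset n} s {i} → i ∈ₛ p → inject₁ i ∈ₛ p ∷ʳ s
inject₁∈∷ʳ⁺ {p = p} s {i} i∈p = lookup⇒[]= _ _ (trans (lookup-∷ʳ-inject₁ p s i) ([]=⇒lookup i∈p))

inject₁∈∷ʳ⁻ : ∀ {n} (p : Subset n) s {i} → inject₁ i ∈ₛ p ∷ʳ s → i ∈ₛ p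
inject₁∈∷ʳ⁻ p s {i} i∈ = lookup⇒[]= i p (trans (sym (lookup-∷ʳ-inject₁ p s i)) ([]=⇒lookup i∈))

fromℕ∈∷ʳ⁺ : ∀ {n} (p : Subset n) → fromℕ n ∈ₛ p ∷ʳ inside
fromℕ∈∷ʳ⁺ p = lookup⇒[]= _ _ (lookup-∷ʳ-fromℕ p inside)

fromℕ∈∷ʳ⁻ : ∀ {n} (p : Subset n) s → fromℕ n ∈ₛ p ∷ʳ s → s ≡ inside
fromℕ∈∷ʳ⁻ p s ∈p = trans (sym (lookup-∷ʳ-fromℕ p s)) ([]=⇒lookup ∈p)

module _ {n p} {P : Fin n → Set p} (P? : ∀ i → Dec (P i)) where

  ∈-tabulate-does⁺ : ∀ {i} → P i → i ∈ₛ tabulate (λ i → does (P? i))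
  ∈-tabulate-does⁺ {i} Pi = lookup⇒[]= i _ (trans (lookup∘tabulate _ i) (dec-true (P? i) Pi))

  ∈-tabulate-does⁻ : ∀ {i} → i ∈ₛ tabulate (λ i → does (P? i)) → P i
  -- Abstracting `P? i` together with the lookup equation turns the latter into `b ≡ true` for the
  -- decision bit `b`, which rules out `false`.
  ∈-tabulate-does⁻ {i} i∈ with P? i | trans (sym (lookup∘tabulate (λ i → does (P? i)) i)) ([]=⇒lookup i∈)
  ... | true because [Pi] | refl = invert [Pi]

-- A row vector is definitionally a subset, `_⊕_` is union and `𝟎` is the empty set, so the
-- library's lemmas on unions apply to Boolean sums directly.
∈-∑⁺ : ∀ {m n} {S : Subset m} {rs : Vec (RowVec n) m} {i j} →
       i ∈ₛ S → j ∈ₛ lookup rs i → j ∈ₛ ∑ S rs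
∈-∑⁺ {S = inside  ∷ S} {_ ∷ _} here        j∈r = x∈p∪q⁺ (inj₁ j∈r)
∈-∑⁺ {S = inside  ∷ S} {_ ∷ _} (there i∈S) j∈r = x∈p∪q⁺ (inj₂ (∈-∑⁺ i∈S j∈r))
∈-∑⁺ {S = outside ∷ S} {_ ∷ _} (there i∈S) j∈r = ∈-∑⁺ i∈S j∈r

∈-∑⁻ : ∀ {m n} (S : Subset m) (rs : Vec (RowVec n) m) {j} →
       j ∈ₛ ∑ S rs → ∃ λ i → i ∈ₛ S × j ∈ₛ lookup rs i
∈-∑⁻ []            []       j∈ with () ← ∉⊥ j∈
∈-∑⁻ (inside  ∷ S) (r ∷ rs) j∈ with x∈p∪q⁻ r (∑ S rs) j∈
... | inj₁ j∈r = zero , here , j∈r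
... | inj₂ j∈∑ = let i , i∈S , j∈r = ∈-∑⁻ S rs j∈∑ in suc i , there i∈S , j∈r
∈-∑⁻ (outside ∷ S) (r ∷ rs) j∈ =
  let i , i∈S , j∈r = ∈-∑⁻ S rs j∈ in suc i , there i∈S , j∈r

-- Antisymmetry is implied by naturality.
record IsPosetMatrix {n} (A : Matrix n) : Set where
  field
    reflexive  : ∀ i → i ∈ₛ lookup A i
    transitive : ∀ {i j k} → i ∈ₛ lookup A j → j ∈ₛ lookup A k → i ∈ₛ lookup A k
    natural    : ∀ {i j} → i ∈ₛ lookup A j → i ≤ j

PM⇒IsPosetMatrix : ∀ {n} {A : Matrix n} → A ∈ PM n → IsPosetMatrix A
PM⇒IsPosetMatrix {n} (P , refl) = record
  { reflexive  = λ i → ∈row⁺ (PO.reflexive refl)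
  ; transitive = λ i≼j j≼k → ∈row⁺ (PO.trans (∈row⁻ i≼j) (∈row⁻ j≼k))
  ; natural    = λ i≼j → natural (∈row⁻ i≼j)
  }
  where
  open NLPoset P
  module PO = IsDecPartialOrder isDecPartialOrder

  row : Fin n → RowVec n
  row i = tabulate λ j → does (j ≼? i)

  ∈row⁺ : ∀ {i j} → j ≼ i → j ∈ₛ lookup (posetMatrix P) i
  ∈row⁺ {i} {j} j≼i = subst (j ∈ₛ_) (sym (lookup∘tabulate row i)) (∈-tabulate-does⁺ (_≼? i) j≼i)

  ∈row⁻ : ∀ {i j} → j ∈ₛ lookup (posetMatrix P) i → j ≼ i
  ∈row⁻ {i} {j} j∈ = ∈-tabulate-does⁻ (_≼? i) (subst (j ∈ₛ_) (lookup∘tabulate row i) j∈)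

-- The order is read off the rows, decidably since the entries are Boolean. Tabulating it gives back
-- `A`, each row being compared as a set.
IsPosetMatrix⇒PM : ∀ {n} {A : Matrix n} → IsPosetMatrix A → A ∈ PM n
IsPosetMatrix⇒PM {n} {A} isPM = P , trans (sym (tabulate∘lookup A)) (tabulate-cong λ i →
  ⊆-antisym (∈-tabulate-does⁺ (_∈? lookup A i)) (∈-tabulate-does⁻ (_∈? lookup A i)))
  where
  open IsPosetMatrix isPM

  P : NLPoset n
  P = record
    { _≼_ = λ j i → j ∈ₛ lookup A i
    ; isDecPartialOrder = record
      { isPartialOrder = record
        { isPreorder = record
          { isEquivalence = isEquivalence
          ; reflexive     = λ { refl → reflexive _ }
          ; trans         = transitive
          }
        ; antisym = λ i≼j j≼i → ≤-antisym (natural i≼j) (natural j≼i)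
        }
      ; _≟_  = _≟_
      ; _≤?_ = λ j i → j ∈? lookup A i
      }
    ; natural = natural
    }

DownClosed : ∀ {n} → Matrix n → RowVec n → Set
DownClosed A v = ∀ {i j} → i ∈ₛ v → j ∈ₛ lookup A i → j ∈ₛ v

module _ {n} {A : Matrix n} (isPM : IsPosetMatrix A) where
  open IsPosetMatrix isPM

  Row𝔹⇒DownClosed : ∀ {v} → v ∈ Row𝔹 A → DownClosed A v
  Row𝔹⇒DownClosed (S , refl) i∈∑ j≼i =
    -- A member `i` of the sum lies below some `k` in `S`; transitivity puts everything below `i`
    -- into the row of the same `k`.
    let k , k∈S , i≼k = ∈-∑⁻ S A i∈∑ in ∈-∑⁺ k∈S (transitive j≼i i≼k)

  DownClosed⇒Row𝔹 : ∀ {v} → DownClosed A v → v ∈ Row𝔹 A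
  -- With `v` as index set, reflexivity gives one inclusion and closure the other.
  DownClosed⇒Row𝔹 {v} closed = v , ⊆-antisym
    (λ i∈v → ∈-∑⁺ i∈v (reflexive _))
    (λ j∈∑ → let i , i∈v , j≼i = ∈-∑⁻ v A j∈∑ in closed i∈v j≼i)

module _ {n} (A : Matrix n) (v : RowVec n) where

  lookup-^ᵛ-inject₁ : ∀ i → lookup (A ^ᵛ v) (inject₁ i) ≡ lookup A i ∷ʳ false
  lookup-^ᵛ-inject₁ i = trans (lookup-∷ʳ-inject₁ (map (_∷ʳ false) A) _ i) (lookup-map i (_∷ʳ false) A)

  lookup-^ᵛ-fromℕ : lookup (A ^ᵛ v) (fromℕ n) ≡ v ∷ʳ true
  lookup-^ᵛ-fromℕ = lookup-∷ʳ-fromℕ (map (_∷ʳ false) A) _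

  -- The labels `inject₁ i` are the old ones; `fromℕ n` is the new one, described by the last row
  -- and column.
  old≼old⁺ : ∀ {i j} → j ∈ₛ lookup A i → inject₁ j ∈ₛ lookup (A ^ᵛ v) (inject₁ i)
  old≼old⁺ {i} j≼i = subst (_ ∈ₛ_) (sym (lookup-^ᵛ-inject₁ i)) (inject₁∈∷ʳ⁺ false j≼i)

  old≼old⁻ : ∀ {i j} → inject₁ j ∈ₛ lookup (A ^ᵛ v) (inject₁ i) → j ∈ₛ lookup A i
  old≼old⁻ {i} j≼i = inject₁∈∷ʳ⁻ _ false (subst (_ ∈ₛ_) (lookup-^ᵛ-inject₁ i) j≼i)

  -- The block `𝟎` in the last column excludes this. The arbitrary `W` lets it close any goal in the
  -- case analyses.
  new⋠old : ∀ {i} {W : Set} → fromℕ n ∈ₛ lookup (A ^ᵛ v) (inject₁ i) → W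
  new⋠old {i} n≼i with () ← fromℕ∈∷ʳ⁻ (lookup A i) false (subst (_ ∈ₛ_) (lookup-^ᵛ-inject₁ i) n≼i)

  old≼new⁺ : ∀ {j} → j ∈ₛ v → inject₁ j ∈ₛ lookup (A ^ᵛ v) (fromℕ n)
  old≼new⁺ j∈v = subst (_ ∈ₛ_) (sym lookup-^ᵛ-fromℕ) (inject₁∈∷ʳ⁺ true j∈v)

  old≼new⁻ : ∀ {j} → inject₁ j ∈ₛ lookup (A ^ᵛ v) (fromℕ n) → j ∈ₛ v
  old≼new⁻ j≼n = inject₁∈∷ʳ⁻ v true (subst (_ ∈ₛ_) lookup-^ᵛ-fromℕ j≼n)

  new≼new : fromℕ n ∈ₛ lookup (A ^ᵛ v) (fromℕ n)
  new≼new = subst (_ ∈ₛ_) (sym lookup-^ᵛ-fromℕ) (fromℕ∈∷ʳ⁺ v)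

  ^ᵛ-isPosetMatrix⇒DownClosed : IsPosetMatrix (A ^ᵛ v) → DownClosed A v
  -- Transitivity is applied to the chain from `j` through `i` to the new label.
  ^ᵛ-isPosetMatrix⇒DownClosed isPM i∈v j≼i = old≼new⁻ (transitive (old≼old⁺ j≼i) (old≼new⁺ i∈v))
    where open IsPosetMatrix isPM

  DownClosed⇒^ᵛ-isPosetMatrix : IsPosetMatrix A → DownClosed A v → IsPosetMatrix (A ^ᵛ v)
  DownClosed⇒^ᵛ-isPosetMatrix isPM closed = record
    { reflexive = reflexive′ ; transitive = transitive′ _ _ _ ; natural = natural′ _ _ }
    where
    open IsPosetMatrix isPM

    reflexive′ : ∀ i → i ∈ₛ lookup (A ^ᵛ v) i
    reflexive′ i with view i
    ... | ‵fromℕ     = new≼new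
    ... | ‵inject₁ i = old≼old⁺ (reflexive i)

    transitive′ : ∀ i j k → i ∈ₛ lookup (A ^ᵛ v) j → j ∈ₛ lookup (A ^ᵛ v) k → i ∈ₛ lookup (A ^ᵛ v) k
    transitive′ i j k i≼j j≼k with view i | view j | view k
    ... | _          | ‵fromℕ     | ‵fromℕ     = i≼j
    ... | _          | ‵fromℕ     | ‵inject₁ k = new⋠old j≼k
    ... | ‵fromℕ     | ‵inject₁ j | _          = new⋠old i≼j
    -- The only case that draws on `closed`: two old labels below the new one.
    ... | ‵inject₁ i | ‵inject₁ j | ‵fromℕ     = old≼new⁺ (closed (old≼new⁻ j≼k) (old≼old⁻ i≼j))
    ... | ‵inject₁ i | ‵inject₁ j | ‵inject₁ k = old≼old⁺ (transitive (old≼old⁻ i≼j) (old≼old⁻ j≼k))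

    natural′ : ∀ i j → i ∈ₛ lookup (A ^ᵛ v) j → i ≤ j
    natural′ i j i≼j with view i | view j
    ... | _          | ‵fromℕ     = ≤fromℕ i
    ... | ‵fromℕ     | ‵inject₁ j = new⋠old i≼j
    ... | ‵inject₁ i | ‵inject₁ j =
      -- `inject₁` preserves the underlying number only propositionally, hence the transport.
      subst₂ ℕ._≤_ (sym (toℕ-inject₁ i)) (sym (toℕ-inject₁ j)) (natural (old≼old⁻ i≼j))

theorem2p4 : ∀ (n : ℕ) (A : Matrix n) → A ∈ PM n → Row𝔹 A ≐ PV n A
theorem2p4 n A A∈PM =
    (λ {v} v∈Row → IsPosetMatrix⇒PM (DownClosed⇒^ᵛ-isPosetMatrix A v isPM (Row𝔹⇒DownClosed isPM v∈Row)))
  , (λ {v} v∈PV → DownClosed⇒Row𝔹 isPM (^ᵛ-isPosetMatrix⇒DownClosed A v (PM⇒IsPosetMatrix v∈PV)))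
  where isPM = PM⇒IsPosetMatrix A∈PM
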